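{- Let $(G,<,\mathbf{q})$ be a stable assignment instance, let $X\in\{A,B\}$ and let $Y$ be the other side. Algorithm $X$-rotate-remove (described below), for any choice made between cases (i) and (ii) at each iteration, terminates and outputs the $Y$-optimal legal assignment; i.e., for $Y=A$ it outputs the legal assignment $M^*$ with $M^*\succeq M$ for every legal $M$, and for $Y=B$ the legal assignment $M^*$ with $M\succeq M^*$ for every legal $M$.
   Context: Setting: $G=(A\cup B,E)$ finite simple bipartite graph (students $A$, schools $B$); $<_v$ a strict total order on the neighbours of each vertex $v$ (write $y>_x y'$, $y\ge_x y'$, and $y>_x\emptyset$ for each neighbour $y$); positive integer quotas $q_b$ for $b\in B$ and $q_a=1$ for $a\in A$. An assignment is $M\subseteq E$ with each vertex $v$ in at most $q_v$ edges; $M(x)=\{y:xy\in M\}$ (for a student, identified with its element or $\emptyset$). Edge $ab$ blocks $M$ if $b>_a M(a)$ and either $|M(b)|<q_b$ or $a>_b a'$ for some $a'\in M(b)$; an assignment blocks $M$ if one of its edges does; $M$ is stable if no edge of the graph blocks it. A set $\mathcal{L}$ of assignments has the legal property if the assignments blocked by some member of $\mathcal{L}$ are exactly those not in $\mathcal{L}$; there is exactly one such set, the legal assignments. $M\succeq M'$ means $M(a)\ge_a M'(a)$ for all $a\in A$. The student-optimal (resp. school-optimal) stable assignment is the stable $M$ with $M\succeq M'$ (resp. $M'\succeq M$) for all stable $M'$. For a subgraph $G'$, $(G',<,\mathbf{q})$ has preferences restricted to $G'$. Rotations: for stable $M$ in an instance and $x\in X$, $s_M(x)$ is the most preferred agent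 $y$ in $x$'s list (in that instance) with $y\notin M(x)$ and $x>_y x'$ for some $x'\in M(y)$ (may not exist); if it exists and $|M(y)|=q_y$, $next_M(x)$ is the $<_y$-least element of $M(y)$, and if $|M(y)|<q_y$, $next_M(x)=\emptyset$. The $X$-rotation digraph of $M$ has vertices $X\cup Y\cup\{\emptyset\}$ and arcs $(x,s_M(x)),(s_M(x),next_M(x))$ for each $x\in X$ with $s_M(x)$ defined. A directed cycle of it corresponds to an $X$-rotation $\rho=y_0,x_0,y_1,x_1,\dots,y_{r-1},x_{r-1}$ with $x_iy_i\in M$, $s_M(x_i)=y_{i+1}$ (indices mod $r$); $M/\rho$ is obtained from $M$ by replacing each $x_iy_i$ with $x_iy_{i+1}$. Algorithm $X$-rotate-remove: let $M^0$ be the $Y$-optimal stable assignment of $(G,<,\mathbf{q})$, $G^0=G$, $i=0$, $D^0$ the $X$-rotation digraph of $M^0$ in $(G^0,<,\mathbf{q})$. While $D^i$ has an arc: find either (i) arcs $(x',y),(y,x)$ of $D^i$ with $x$ a sink of $D^i$, or (ii) a directed cycle of $D^i$ (if both exist, either may be chosen). In case (i), $G^{i+1}$ is $G^i$ with edge $x'y$ removed and $M^{i+1}=M^i$; in case (ii), with $\rho^i$ the corresponding $X$-rotation, $M^{i+1}=M^i/\rho^i$ and $G^{i+1}=G^i$. Set $i:=i+1$ and let $D^i$ be the $X$-rotation digraph of $M^i$ in $(G^i,<,\mathbf{q})$. When $D^i$ has no arc, output $M^i$. -}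

module Defs where

open import Data.Nat using (ℕ; zero; suc; _+_; _<_; _≤_)
open import Data.Nat.DivMod using (_%_; m%n<n)
open import Data.Fin using (Fin; toℕ; fromℕ<)
open import Data.Bool using (Bool; true; false)
open import Data.Vec using (Vec; lookup)
open import Data.List using (List; map; allFin; foldr)
open import Data.Product using (Σ; ∃; ∃-syntax; _×_; _,_; proj₁; proj₂)
open import Data.Sum using (_⊎_)
open import Data.Empty using (⊥)
open import Relation.Nullary using (¬_)
open import Relation.Binary.PropositionalEquality using (_≡_; _≢_)
open import Function.Definitions using (Injective)
open import Function.Bundles using (_⇔_)

-- A = students, B = schools
data Side : Set where
  A B : Side

other : Side → Side
other A = B
other B = A

-- Students are Fin nA, schools are Fin nB.  A (simple bipartite) graph,
-- and likewise an edge set M ⊆ A × B (an assignment candidate), is an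
-- nA × nB Boolean adjacency matrix.
Graph : ℕ → ℕ → Set
Graph nA nB = Vec (Vec Bool nB) nA

-- Preferences: a rank function for every vertex (smaller rank = more
-- preferred), required (in WellFormed) to be injective on the
-- neighbourhood of the vertex, i.e. a strict total order on neighbours.
-- Quotas q_b of schools; students have quota 1.
record Prefs (nA nB : ℕ) : Set where
  field
    rankA  : Fin nA → Fin nB → ℕ
    rankB  : Fin nB → Fin nA → ℕ
    quotaB : Fin nB → ℕ

open Prefs public

countTrue : List Bool → ℕ
countTrue = foldr (λ { true n → suc n ; false n → n }) 0

sucMod : ∀ {n} → Fin n → Fin n
sucMod {suc n} i = fromℕ< (m%n<n (suc (toℕ i)) (suc n))

module _ {nA nB : ℕ} where

  entry : Graph nA nB → Fin nA × Fin nB → Bool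
  entry H (a , b) = lookup (lookup H a) b

  _∋_ : Graph nA nB → Fin nA × Fin nB → Set
  H ∋ e = entry H e ≡ true

  degA : Graph nA nB → Fin nA → ℕ
  degA M a = countTrue (map (λ b → entry M (a , b)) (allFin nB))

  degB : Graph nA nB → Fin nB → ℕ
  degB M b = countTrue (map (λ a → entry M (a , b)) (allFin nA))

  IsAssignment : Graph nA nB → Prefs nA nB → Graph nA nB → Set
  IsAssignment G P M =
    (∀ a b → M ∋ (a , b) → G ∋ (a , b)) ×
    (∀ a → degA M a ≤ 1) ×
    (∀ b → degB M b ≤ quotaB P b)

  -- edge ab blocks M: b >_a M(a) (true if M(a) = ∅) and
  -- (|M(b)| < q_b or a >_b a' for some a' ∈ M(b))
  EdgeBlocks : Prefs nA nB → Graph nA nB → Fin nA → Fin nB → Set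
  EdgeBlocks P M a b =
    (∀ b' → M ∋ (a , b') → rankA P a b < rankA P a b') ×
    (degB M b < quotaB P b ⊎
     ∃[ a' ] (M ∋ (a' , b) × rankB P b a < rankB P b a'))

  Blocks : Prefs nA nB → Graph nA nB → Graph nA nB → Set
  Blocks P M' M = ∃[ a ] ∃[ b ] (M' ∋ (a , b) × EdgeBlocks P M a b)

  Stable : Graph nA nB → Prefs nA nB → Graph nA nB → Set
  Stable G P M =
    IsAssignment G P M × (∀ a b → G ∋ (a , b) → ¬ EdgeBlocks P M a b)

  -- M ⪰ M' : M(a) ≥_a M'(a) for every student a
  -- (anything is ≥_a ∅; b ≥_a b' means b = b' or b >_a b')
  _⊢_⪰_ : Prefs nA nB → Graph nA nB → Graph nA nB → Set
  P ⊢ M ⪰ M' = ∀ a b' → M' ∋ (a , b') →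
    ∃[ b ] (M ∋ (a , b) × (b ≡ b' ⊎ rankA P a b < rankA P a b'))

  -- "M is at least as good as M' for side Y = other X"
  YBetter : Prefs nA nB → Side → Graph nA nB → Graph nA nB → Set
  YBetter P B M M' = P ⊢ M ⪰ M'      -- Y = A (students)
  YBetter P A M M' = P ⊢ M' ⪰ M      -- Y = B (schools)

  YOptimalStable : Graph nA nB → Prefs nA nB → Side → Graph nA nB → Set
  YOptimalStable G P X M₀ =
    Stable G P M₀ × (∀ M → Stable G P M → YBetter P X M₀ M)

  AsgSet : Set
  AsgSet = Graph nA nB → Bool

  LegalProperty : Graph nA nB → Prefs nA nB → AsgSet → Set
  LegalProperty G P L =
    (∀ M → L M ≡ true → IsAssignment G P M) ×
    (∀ M → IsAssignment G P M →
       ((∃[ M' ] (L M' ≡ true × Blocks P M' M)) ⇔ (L M ≡ false)))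

  -- M* is the Y-optimal legal assignment (with respect to the legal set,
  -- which is the unique set with the legal property)
  YOptimalLegal : Graph nA nB → Prefs nA nB → Side → Graph nA nB → Set
  YOptimalLegal G P X M* =
    ∀ L → LegalProperty G P L →
      (L M* ≡ true) × (∀ M → L M ≡ true → YBetter P X M* M)

  V : Side → Set
  V A = Fin nA
  V B = Fin nB

  allV : (X : Side) → List (V X)
  allV A = allFin nA
  allV B = allFin nB

  edge : (X : Side) → V X → V (other X) → Fin nA × Fin nB
  edge A a b = a , b
  edge B b a = a , b

  rankX : Prefs nA nB → (X : Side) → V X → V (other X) → ℕ
  rankX P A = rankA P
  rankX P B = rankB P

  rankY : Prefs nA nB → (X : Side) → V (other X) → V X → ℕ
  rankY P A = rankB P
  rankY P B = rankA P

  quotaY : Prefs nA nB → (X : Side) → V (other X) → ℕ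
  quotaY P A = quotaB P
  quotaY P B = λ _ → 1

  degY : Graph nA nB → (X : Side) → V (other X) → ℕ
  degY M X y = countTrue (map (λ x → entry M (edge X x y)) (allV X))

  Cand : Graph nA nB → Prefs nA nB → Graph nA nB →
         (X : Side) → V X → V (other X) → Set
  Cand H P M X x y =
    H ∋ edge X x y × ¬ (M ∋ edge X x y) ×
    ∃[ x' ] (M ∋ edge X x' y × rankY P X y x < rankY P X y x')

  IsS : Graph nA nB → Prefs nA nB → Graph nA nB →
        (X : Side) → V X → V (other X) → Set
  IsS H P M X x y =
    Cand H P M X x y × (∀ y' → Cand H P M X x y' → rankX P X x y ≤ rankX P X x y')

  data Node (X : Side) : Set where
    xN : V X → Node X
    yN : V (other X) → Node X
    ∅N : Node X

  -- n is next_M(x) for any x with s_M(x) = y (it depends only on y):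
  -- the <_y-least element of M(y) if |M(y)| = q_y, and ∅ if |M(y)| < q_y
  NextOf : Prefs nA nB → Graph nA nB → (X : Side) → V (other X) → Node X → Set
  NextOf P M X y (xN x') =
    degY M X y ≡ quotaY P X y × M ∋ edge X x' y ×
    (∀ x'' → M ∋ edge X x'' y → rankY P X y x'' ≤ rankY P X y x')
  NextOf P M X y (yN _) = ⊥
  NextOf P M X y ∅N = degY M X y < quotaY P X y

  Arc : Graph nA nB → Prefs nA nB → Graph nA nB → (X : Side) → Node X → Node X → Set
  Arc H P M X (xN x) (yN y) = IsS H P M X x y
  Arc H P M X (xN x) (xN _) = ⊥
  Arc H P M X (xN x) ∅N = ⊥
  Arc H P M X (yN y) n = (∃[ x ] IsS H P M X x y) × NextOf P M X y n
  Arc H P M X ∅N _ = ⊥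

  Sink : Graph nA nB → Prefs nA nB → Graph nA nB → (X : Side) → Node X → Set
  Sink H P M X n = ∀ n' → ¬ Arc H P M X n n'

  -- a directed cycle x₀ → y₁ → x₁ → y₂ → … → x_{r-1} → y₀ → x₀ of the
  -- digraph (its vertices are pairwise distinct); it corresponds to the
  -- X-rotation y₀,x₀,y₁,x₁,…,y_{r-1},x_{r-1}.  Indices are mod r.
  record Rotation (H : Graph nA nB) (P : Prefs nA nB) (M : Graph nA nB)
                  (X : Side) : Set where
    field
      r-1   : ℕ
      xs    : Fin (suc r-1) → V X
      ys    : Fin (suc r-1) → V (other X)
      xs-inj : Injective _≡_ _≡_ xs
      ys-inj : Injective _≡_ _≡_ ys
      arcXY : ∀ i → Arc H P M X (xN (xs i)) (yN (ys (sucMod i)))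
      arcYX : ∀ i → Arc H P M X (yN (ys (sucMod i))) (xN (xs (sucMod i)))

  RotatedBy : ∀ {H P M X} → Rotation H P M X → Graph nA nB → Set
  RotatedBy {M = M} {X = X} ρ M' = ∀ a b →
    (M' ∋ (a , b)) ⇔
      ((M ∋ (a , b) × (∀ i → edge X (xs i) (ys i) ≢ (a , b))) ⊎
       (∃[ i ] (edge X (xs i) (ys (sucMod i)) ≡ (a , b))))
    where open Rotation ρ

  RemovedEdge : Graph nA nB → Fin nA × Fin nB → Graph nA nB → Set
  RemovedEdge H e H' = ∀ a b →
    (H' ∋ (a , b)) ⇔ (H ∋ (a , b) × e ≢ (a , b))

  -- Algorithm X-rotate-remove as a (nondeterministic) transition system
  -- on states (G^i , M^i)

  State : Set
  State = Graph nA nB × Graph nA nB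

  HasArc : Prefs nA nB → Side → State → Set
  HasArc P X (H , M) = ∃[ u ] ∃[ v ] Arc H P M X u v

  data Step (P : Prefs nA nB) (X : Side) : State → State → Set where
    case-i  : ∀ {H M H'} (x' : V X) (y : V (other X)) (n : Node X) →
              Arc H P M X (xN x') (yN y) → Arc H P M X (yN y) n →
              Sink H P M X n → RemovedEdge H (edge X x' y) H' →
              Step P X (H , M) (H' , M)
    case-ii : ∀ {H M M'} (ρ : Rotation H P M X) → RotatedBy ρ M' →
              Step P X (H , M) (H , M')

  WellFormed : Graph nA nB → Prefs nA nB → Set
  WellFormed G P =
    (∀ a b b' → G ∋ (a , b) → G ∋ (a , b') → rankA P a b ≡ rankA P a b' → b ≡ b') ×
    (∀ b a a' → G ∋ (a , b) → G ∋ (a' , b) → rankB P b a ≡ rankB P b a' → a ≡ a') ×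
    (∀ b → 1 ≤ quotaB P b)

{-# OPTIONS --safe #-}

-- Fix a set L with the legal property; its members do not block each other, and an assignment
-- blocked by no member belongs to L. Along every run, M lies in L and H contains all edges of
-- members of L. For a removal of x'y at a sink, a legal M' containing x'y would, by double
-- counting over the students who prefer one of M, M' to the other, make the worst partner of y
-- have a candidate in H, contradicting that it is a sink. For a rotation, M/ρ is blocked by no
-- edge of H whose Y-end is full; the undersubscribed Y-vertices have the same partners in all
-- legal assignments, so no legal edge blocks M/ρ. When no arc is left, M is legal and no y has
-- a candidate, and the same double counting shows that M is Y-optimal.
-- Termination: each step removes an edge of H or lowers the sum of the Y-ranks over M.
-- Progress: following x ↦ next(s(x)) from an arc reaches a sink or closes a cycle.
module Submission where

open import Defs
open import Data.Bool using (Bool; true; false; _∧_; not)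
import Data.Bool.Properties as Bool
open import Data.Empty using (⊥; ⊥-elim)
open import Data.Fin using (Fin; zero; suc; toℕ; fromℕ; inject₁)
import Data.Fin.Properties as Fin
open import Data.List using (map; tabulate; allFin)
open import Data.Nat using (ℕ; zero; suc; _+_; _*_; _∸_; _<_; _≤_; z≤n; s≤s; _≤?_; _<?_)
open import Data.Nat.DivMod using (_%_; m<n⇒m%n≡m; n%n≡0)
open import Data.Nat.Induction using (<-wellFounded)
open import Data.Nat.Properties
open import Data.Product using (Σ; ∃; ∃₂; _×_; _,_; proj₁; proj₂; uncurry)
open import Data.Product.Properties using (≡-dec)
open import Data.Sum using (_⊎_; inj₁; inj₂; reduce)
import Data.Vec as Vec
open import Data.Vec.Properties using (lookup∘tabulate)
open import Function using (_∘_; case_of_)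
open import Function.Bundles using (_⇔_; mk⇔; Equivalence)
open import Function.Definitions using (Injective)
open import Induction.WellFounded using (Acc; module Subrelation)
open import Relation.Binary.Construct.Closure.ReflexiveTransitive using (Star; ε; _◅_)
import Relation.Binary.Construct.On as On
open import Relation.Binary.Definitions using (Total; Transitive; tri<; tri≈; tri>)
open import Relation.Binary.PropositionalEquality
open import Relation.Nullary using (¬_; Dec; yes; no; does; contradiction)
open import Relation.Nullary.Decidable using (_×-dec_; _⊎-dec_; _→-dec_; ¬?; dec-true; dec-false)
open import Relation.Unary using (Decidable)
open import Algebra.Properties.CommutativeMonoid.Sum +-0-commutativeMonoid
  using (sum; sum-cong-≗; ∑-distrib-+; ∑-comm; sum-replicate-zero)

-- Finite sums

sum-mono-≤ : ∀ {n} {f g : Fin n → ℕ} → (∀ i → f i ≤ g i) → sum f ≤ sum g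
sum-mono-≤ {zero}  f≤g = z≤n
sum-mono-≤ {suc n} f≤g = +-mono-≤ (f≤g zero) (sum-mono-≤ (f≤g ∘ suc))

sum-mono-< : ∀ {n} {f g : Fin n → ℕ} → (∀ i → f i ≤ g i) → ∀ i → f i < g i → sum f < sum g
sum-mono-< f≤g zero    fi<gi = +-mono-<-≤ fi<gi (sum-mono-≤ (f≤g ∘ suc))
sum-mono-< f≤g (suc i) fi<gi = +-mono-≤-< (f≤g zero) (sum-mono-< (f≤g ∘ suc) i fi<gi)

sum-squeeze : ∀ {n} {f g : Fin n → ℕ} → (∀ i → f i ≤ g i) → sum g ≤ sum f → ∀ i → f i ≡ g i
sum-squeeze {f = f} {g} f≤g ∑g≤∑f i with f i <? g i
... | yes fi<gi = contradiction (sum-mono-< f≤g i fi<gi) (≤⇒≯ ∑g≤∑f)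
... | no  fi≮gi = ≤-antisym (f≤g i) (≮⇒≥ fi≮gi)

-- Adding up the rows gives one inequality between the two totals and adding up the columns gives
-- the reverse one. The totals therefore agree, and every single row and column inequality must be
-- tight.
double-counting : ∀ {m n} (f g : Fin m → Fin n → ℕ) →
  (∀ i → sum (g i) ≤ sum (f i)) →
  (∀ j → sum (λ i → f i j) ≤ sum (λ i → g i j)) →
  (∀ i → sum (g i) ≡ sum (f i)) × (∀ j → sum (λ i → f i j) ≡ sum (λ i → g i j))
double-counting f g rows cols =
  sum-squeeze rows (subst₂ _≤_ (sym (∑-comm f)) (sym (∑-comm g)) (sum-mono-≤ cols)) ,
  sum-squeeze cols (subst₂ _≤_ (∑-comm g) (∑-comm f) (sum-mono-≤ rows))

-- A point mass at an index, defined by recursion on that index so that its total computes along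
-- `sum`.
single : ∀ {n} → Fin n → (Fin n → ℕ) → Fin n → ℕ
single zero    w zero    = w zero
single zero    w (suc j) = 0
single (suc i) w zero    = 0
single (suc i) w (suc j) = single i (w ∘ suc) j

sum-single : ∀ {n} (i : Fin n) (w : Fin n → ℕ) → sum (single i w) ≡ w i
sum-single {suc n} zero    w = trans (cong (w zero +_) (sum-replicate-zero n)) (+-identityʳ (w zero))
sum-single {suc n} (suc i) w = sum-single i (w ∘ suc)

single-refl : ∀ {n} (i : Fin n) w → single i w i ≡ w i
single-refl zero    w = refl
single-refl (suc i) w = single-refl i (w ∘ suc)

single-≢ : ∀ {n} {i j : Fin n} w → j ≢ i → single i w j ≡ 0
single-≢ {i = zero}  {zero}  w j≢i = contradiction refl j≢i
single-≢ {i = zero}  {suc j} w j≢i = refl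
single-≢ {i = suc i} {zero}  w j≢i = refl
single-≢ {i = suc i} {suc j} w j≢i = single-≢ (w ∘ suc) (j≢i ∘ cong suc)

-- Weights and counts of Boolean predicates

ind : Bool → ℕ
ind true  = 1
ind false = 0

weight : ∀ {n} → (Fin n → ℕ) → (Fin n → Bool) → ℕ
weight w p = sum (λ i → ind (p i) * w i)

count : ∀ {n} → (Fin n → Bool) → ℕ
count p = sum (ind ∘ p)

true-or-false : ∀ b → b ≡ true ⊎ b ≡ false
true-or-false true  = inj₁ refl
true-or-false false = inj₂ refl

ind-mono : ∀ {p q} → (p ≡ true → q ≡ true) → ind p ≤ ind q
ind-mono {false} p⇒q = z≤n
ind-mono {true}  p⇒q rewrite p⇒q refl = ≤-refl

ind-injective : ∀ {p q} → ind p ≡ ind q → p ≡ true → q ≡ true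
ind-injective {true} {true} eq refl = refl

-- Models what a rotation does to one row or one column of an adjacency matrix: the partner `u` is
-- replaced by `v`.
record Swap {S : Set} (p p′ : S → Bool) (u v : S) : Set where
  field
    p-u  : p u ≡ true
    p-v  : p v ≡ false
    p′-u : p′ u ≡ false
    p′-v : p′ v ≡ true
    rest : ∀ i → i ≢ u → i ≢ v → p′ i ≡ p i

-- Stated with additions on both sides to avoid truncated subtraction. Adding a point mass at `u` on
-- the left and one at `v` on the right makes the summands agree at every index.
weight-swap : ∀ {n} (w : Fin n → ℕ) {p p′ : Fin n → Bool} {u v} → Swap p p′ u v →
  weight w p′ + w u ≡ weight w p + w v
weight-swap {n} w {p} {p′} {u} {v} s = begin
  weight w p′ + w u                               ≡⟨ cong (weight w p′ +_) (sum-single u w) ⟨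
  weight w p′ + sum (single u w)                  ≡⟨ ∑-distrib-+ (λ i → ind (p′ i) * w i) (single u w) ⟨
  sum (λ i → ind (p′ i) * w i + single u w i)     ≡⟨ sum-cong-≗ pointwise ⟩
  sum (λ i → ind (p i) * w i + single v w i)      ≡⟨ ∑-distrib-+ (λ i → ind (p i) * w i) (single v w) ⟩
  weight w p + sum (single v w)                   ≡⟨ cong (weight w p +_) (sum-single v w) ⟩
  weight w p + w v                                ∎
  where
  open ≡-Reasoning
  open Swap s
  u≢v : u ≢ v
  u≢v refl = case trans (sym p-u) p-v of λ ()
  pointwise : ∀ i → ind (p′ i) * w i + single u w i ≡ ind (p i) * w i + single v w i
  pointwise i with i Fin.≟ u
  ... | yes refl rewrite p-u | p′-u | single-refl u w | single-≢ w u≢v =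
    trans (sym (+-identityʳ (w u))) (sym (+-identityʳ (w u + 0)))
  ... | no i≢u with i Fin.≟ v
  ... | yes refl rewrite p-v | p′-v | single-refl v w | single-≢ w i≢u =
    trans (+-identityʳ (w v + 0)) (+-identityʳ (w v))
  ... | no i≢v rewrite rest i i≢u i≢v | single-≢ w i≢u | single-≢ w i≢v = refl

count≡weight : ∀ {n} (p : Fin n → Bool) → count p ≡ weight (λ _ → 1) p
count≡weight p = sum-cong-≗ (λ i → sym (*-identityʳ (ind (p i))))

count-swap : ∀ {n} {p p′ : Fin n → Bool} {u v} → Swap p p′ u v → count p′ ≡ count p
count-swap {p = p} {p′} s =
  trans (count≡weight p′)
    (trans (+-cancelʳ-≡ 1 _ _ (weight-swap (λ _ → 1) s)) (sym (count≡weight p)))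

count-mono : ∀ {n} (p q : Fin n → Bool) → (∀ i → p i ≡ true → q i ≡ true) → count p ≤ count q
count-mono p q p⇒q = sum-mono-≤ (λ i → ind-mono (p⇒q i))

count-∃ : ∀ {n} (p : Fin n → Bool) i → p i ≡ true → 1 ≤ count p
count-∃ p i pi = subst (_≤ count p) (sum-single i (λ _ → 1)) (sum-mono-≤ below)
  where
  below : ∀ j → single i (λ _ → 1) j ≤ ind (p j)
  below j with j Fin.≟ i
  ... | yes refl rewrite pi | single-refl i (λ _ → 1) = ≤-refl
  ... | no j≢i rewrite single-≢ (λ _ → 1) j≢i = z≤n

∃-count : ∀ {n} (p : Fin n → Bool) → 1 ≤ count p → ∃ λ i → p i ≡ true
∃-count {n} p 1≤ with Fin.any? (λ i → p i Bool.≟ true)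
... | yes found = found
... | no  none  = contradiction 1≤ (<⇒≱ (s≤s (≤-reflexive
        (trans (sum-cong-≗ (λ i → cong ind (Bool.¬-not (none ∘ (i ,_))))) (sum-replicate-zero n)))))

count≤1⇒unique : ∀ {n} (p : Fin n → Bool) → count p ≤ 1 → ∀ i j → p i ≡ true → p j ≡ true → i ≡ j
count≤1⇒unique p ≤1 i j pi pj with i Fin.≟ j
... | yes i≡j = i≡j
... | no  i≢j = contradiction ≤1 (<⇒≱ 2≤)
  where
  one : Fin _ → ℕ
  one _ = 1
  below : ∀ k → single i one k + single j one k ≤ ind (p k)
  below k with k Fin.≟ i
  ... | yes refl rewrite pi | single-refl i one | single-≢ one i≢j = ≤-refl
  ... | no k≢i with k Fin.≟ j
  ... | yes refl rewrite pj | single-refl j one | single-≢ one k≢i = ≤-refl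
  ... | no k≢j rewrite single-≢ one k≢i | single-≢ one k≢j = z≤n
  2≤ : 2 ≤ count p
  2≤ = subst (_≤ count p)
    (trans (∑-distrib-+ (single i one) (single j one)) (cong₂ _+_ (sum-single i one) (sum-single j one)))
    (sum-mono-≤ below)

count-split : ∀ {n} (p q : Fin n → Bool) →
  count p ≡ count (λ i → p i ∧ q i) + count (λ i → p i ∧ not (q i))
count-split p q = trans (sum-cong-≗ (λ i → lem (p i) (q i))) (∑-distrib-+ (λ i → ind (p i ∧ q i)) _)
  where
  lem : ∀ p q → ind p ≡ ind (p ∧ q) + ind (p ∧ not q)
  lem false q     = refl
  lem true  true  = refl
  lem true  false = refl

countTrue-tabulate : ∀ {m n} (f : Fin m → Bool) (g : Fin n → Fin m) →
  countTrue (map f (tabulate g)) ≡ count (f ∘ g)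
countTrue-tabulate {n = zero}  f g = refl
countTrue-tabulate {n = suc n} f g with f (g zero)
... | true  = cong suc (countTrue-tabulate f (g ∘ suc))
... | false = countTrue-tabulate f (g ∘ suc)

countTrue-allFin : ∀ {n} (f : Fin n → Bool) → countTrue (map f (allFin n)) ≡ count f
countTrue-allFin f = countTrue-tabulate f (λ i → i)

-- Cyclic successor and cycles of self-maps of finite sets

sucMod-view : ∀ {n} (i : Fin (suc n)) →
  toℕ (sucMod i) ≡ suc (toℕ i) ⊎ (toℕ i ≡ n × toℕ (sucMod i) ≡ 0)
sucMod-view {n} i with m≤n⇒m<n∨m≡n (Fin.toℕ<n i)
... | inj₁ 1+i<1+n = inj₁ (trans (Fin.toℕ-fromℕ< _) (m<n⇒m%n≡m 1+i<1+n))
... | inj₂ 1+i≡1+n = inj₂ (suc-injective 1+i≡1+n ,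
        trans (Fin.toℕ-fromℕ< _) (trans (cong (_% suc n) 1+i≡1+n) (n%n≡0 (suc n))))

sucMod-injective : ∀ {n} {i j : Fin (suc n)} → sucMod i ≡ sucMod j → i ≡ j
sucMod-injective {n} {i} {j} eq with sucMod-view i | sucMod-view j
... | inj₁ i′ | inj₁ j′ = Fin.toℕ-injective (suc-injective (trans (sym i′) (trans (cong toℕ eq) j′)))
... | inj₁ i′ | inj₂ (_ , j′) = case trans (sym i′) (trans (cong toℕ eq) j′) of λ ()
... | inj₂ (_ , i′) | inj₁ j′ = case trans (sym i′) (trans (cong toℕ eq) j′) of λ ()
... | inj₂ (i≡n , _) | inj₂ (j≡n , _) = Fin.toℕ-injective (trans i≡n (sym j≡n))

sucMod-surjective : ∀ {n} (i : Fin (suc n)) → ∃ λ j → sucMod j ≡ i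
sucMod-surjective {n} zero = fromℕ n , Fin.toℕ-injective (last (sucMod-view (fromℕ n)))
  where
  last : toℕ (sucMod (fromℕ n)) ≡ suc (toℕ (fromℕ n)) ⊎ (toℕ (fromℕ n) ≡ n × toℕ (sucMod (fromℕ n)) ≡ 0) →
         toℕ (sucMod (fromℕ n)) ≡ 0
  last (inj₂ (_ , eq)) = eq
  last (inj₁ eq) = contradiction (Fin.toℕ<n (sucMod (fromℕ n)))
    (≤⇒≯ (≤-reflexive (sym (trans eq (cong suc (Fin.toℕ-fromℕ n))))))
sucMod-surjective {suc n} (suc i) = inject₁ i , Fin.toℕ-injective (next (sucMod-view (inject₁ i)))
  where
  next : toℕ (sucMod (inject₁ i)) ≡ suc (toℕ (inject₁ i)) ⊎
         (toℕ (inject₁ i) ≡ suc n × toℕ (sucMod (inject₁ i)) ≡ 0) →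
         toℕ (sucMod (inject₁ i)) ≡ suc (toℕ i)
  next (inj₁ eq) = trans eq (cong suc (Fin.toℕ-inject₁ i))
  next (inj₂ (eq , _)) = contradiction (trans (sym (Fin.toℕ-inject₁ i)) eq) (<⇒≢ (Fin.toℕ<n i))

least : ∀ {P : ℕ → Set} → Decidable P → ∀ {n} → P n → ∃ λ m → P m × ∀ k → k < m → ¬ P k
least P? {zero} p0 = 0 , p0 , λ _ ()
least {P} P? {suc n} pn with P? 0
... | yes p0 = 0 , p0 , λ _ ()
... | no ¬p0 with m , pm , min ← least {P ∘ suc} (P? ∘ suc) pn =
  suc m , pm , λ { zero _ → ¬p0 ; (suc k) (s≤s k<m) → min k k<m }

orbit : ∀ {S : Set} → (S → S) → S → ℕ → S
orbit f x zero    = x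
orbit f x (suc k) = f (orbit f x k)

orbit-+ : ∀ {S : Set} (f : S → S) x k m → orbit f x (k + m) ≡ orbit f (orbit f x m) k
orbit-+ f x zero    m = refl
orbit-+ f x (suc k) m = cong f (orbit-+ f x k m)

orbit-returns : ∀ {n} (f : Fin n → Fin n) x₀ → ∃₂ λ i d → orbit f (orbit f x₀ i) (suc d) ≡ orbit f x₀ i
orbit-returns {n} f x₀ with i , j , i<j , eq ← Fin.pigeonhole (n<1+n n) (orbit f x₀ ∘ toℕ) =
  -- The return time is the positive difference of `j` and `i`; `d` is its predecessor.
  toℕ i , toℕ j ∸ suc (toℕ i) ,
  trans (sym (orbit-+ f x₀ (suc (toℕ j ∸ suc (toℕ i))) (toℕ i)))
    (trans (cong (orbit f x₀) (trans (sym (+-suc (toℕ j ∸ suc (toℕ i)) (toℕ i))) (m∸n+n≡m i<j))) (sym eq))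

-- The first return of an orbit to one of its points closes up an injective cycle.
cycle : ∀ {n} (f : Fin n → Fin n) (Q : Fin n → Set) → (∀ {x} → Q x → Q (f x)) → ∀ x₀ → Q x₀ →
  ∃ λ r → Σ (Fin (suc r) → Fin n) λ c →
    Injective _≡_ _≡_ c × (∀ t → c (sucMod t) ≡ f (c t)) × (∀ t → Q (c t))
cycle {n} f Q Qf x₀ Qx₀
  with i , d , back ← orbit-returns f x₀
  with r , ret , first ← least (λ k → orbit f (orbit f x₀ i) (suc k) Fin.≟ orbit f x₀ i) {d} back =
  r , orbit f w ∘ toℕ , injective , step , λ t → Q-orbit (Q-orbit Qx₀ i) (toℕ t)
  where
  w : Fin n
  w = orbit f x₀ i
  Q-orbit : ∀ {x} → Q x → ∀ k → Q (orbit f x k)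
  Q-orbit Qx zero    = Qx
  Q-orbit Qx (suc k) = Qf (Q-orbit Qx k)
  -- If the iterates at times `t` and `u` agreed, applying `f` another `suc (r ∸ u)` times would
  -- bring both back to `w`. Counted from `t`, that is a return earlier than the first one.
  distinct : ∀ {t u} → t < u → u ≤ r → orbit f w t ≢ orbit f w u
  distinct {t} {u} t<u u≤r eq = first ((r ∸ u) + t)
    (subst ((r ∸ u) + t <_) (m∸n+n≡m u≤r) (+-monoʳ-< (r ∸ u) t<u))
    (trans (orbit-+ f w (suc (r ∸ u)) t)
      (trans (cong (λ z → orbit f z (suc (r ∸ u))) eq)
        (trans (sym (orbit-+ f w (suc (r ∸ u)) u))
          (trans (cong (orbit f w ∘ suc) (m∸n+n≡m u≤r)) ret))))
  injective : Injective _≡_ _≡_ (orbit f w ∘ toℕ {suc r})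
  injective {t} {u} eq with <-cmp (toℕ t) (toℕ u)
  ... | tri< t<u _ _ = contradiction eq (distinct t<u (≤-pred (Fin.toℕ<n u)))
  ... | tri≈ _ t≡u _ = Fin.toℕ-injective t≡u
  ... | tri> _ _ u<t = contradiction (sym eq) (distinct u<t (≤-pred (Fin.toℕ<n t)))
  step : ∀ t → orbit f w (toℕ (sucMod t)) ≡ f (orbit f w (toℕ t))
  step t with sucMod-view t
  ... | inj₁ eq = cong (orbit f w) eq
  ... | inj₂ (t≡r , eq) = trans (cong (orbit f w) eq) (sym (trans (cong (f ∘ orbit f w) t≡r) ret))

-- Extrema and finite case distinctions

-- The order is a parameter so that the reversed order gives a maximum. Reflexivity is extracted
-- from totality at equal arguments.
extremum : ∀ {n} {_≼_ : ℕ → ℕ → Set} → Total _≼_ → Transitive _≼_ →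
  {P : Fin n → Set} → Decidable P → (f : Fin n → ℕ) → ∃ P →
  ∃ λ i → P i × ∀ j → P j → f i ≼ f j
extremum {suc n} {_≼_} total trns {P} P? f ∃P with P? zero | Fin.any? (P? ∘ suc)
extremum {suc n} total trns P? f (zero , p)  | no ¬p | no _  = contradiction p ¬p
extremum {suc n} total trns P? f (suc i , p) | no _  | no ¬p = contradiction (i , p) ¬p
extremum {suc n} {_≼_} total trns {P} P? f _ | yes p | no ¬q = zero , p , min
  where
  min : ∀ j → P j → f zero ≼ f j
  min zero    _ = reduce (total (f zero) (f zero))
  min (suc j) q = contradiction (j , q) ¬q
extremum {suc n} {_≼_} total trns {P} P? f _ | no ¬p | yes q
  with i , pi , min ← extremum total trns (P? ∘ suc) (f ∘ suc) q =
  suc i , pi , λ { zero p → contradiction p ¬p ; (suc j) pj → min j pj }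
extremum {suc n} {_≼_} total trns {P} P? f _ | yes p | yes q
  with i , pi , min ← extremum total trns (P? ∘ suc) (f ∘ suc) q
  with total (f zero) (f (suc i))
... | inj₁ 0≼i = zero , p ,
  λ { zero _ → reduce (total (f zero) (f zero)) ; (suc j) pj → trns 0≼i (min j pj) }
... | inj₂ i≼0 = suc i , pi , λ { zero _ → i≼0 ; (suc j) pj → min j pj }

-- For the progress proof: `C` is the existence of a step, so either some vertex supplies one or the
-- local data are available at all vertices at once.
finite-choice : ∀ {n} {C : Set} {P : Fin n → Set} → (∀ i → C ⊎ P i) → C ⊎ (∀ i → P i)
finite-choice {zero}  h = inj₂ λ ()
finite-choice {suc n} h with h zero | finite-choice (h ∘ suc)
... | inj₁ c | _      = inj₁ c
... | inj₂ _ | inj₁ c = inj₁ c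
... | inj₂ p | inj₂ q = inj₂ λ { zero → p ; (suc i) → q i }

-- Two assignments that do not block each other

-- Restrict M₁ and M₂ to the set S of students strictly preferring M₁. Every student of S has
-- exactly one M₁-edge and at most one M₂-edge, while non-blocking forces every school to have
-- at least as many M₂-edges to S as M₁-edges. Double counting makes all of these equalities;
-- the rural hospitals theorem and the exchange properties below are read off from them.

module _ {nA nB : ℕ} where

  ∋? : (M : Graph nA nB) → Decidable (M ∋_)
  ∋? M e = entry M e Bool.≟ true

  degA≡count : (M : Graph nA nB) → ∀ a → degA M a ≡ count (λ b → entry M (a , b))
  degA≡count M a = countTrue-allFin (λ b → entry M (a , b))

  degB≡count : (M : Graph nA nB) → ∀ b → degB M b ≡ count (λ a → entry M (a , b))
  degB≡count M b = countTrue-allFin (λ a → entry M (a , b))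

  partner-unique : ∀ G P (M : Graph nA nB) → IsAssignment G P M →
    ∀ a b b′ → M ∋ (a , b) → M ∋ (a , b′) → b ≡ b′
  partner-unique G P M (_ , ≤1 , _) a =
    count≤1⇒unique (λ b → entry M (a , b)) (subst (_≤ 1) (degA≡count M a) (≤1 a))

module Compare {nA nB : ℕ} (G : Graph nA nB) (P : Prefs nA nB) (wf : WellFormed G P)
  (M₁ M₂ : Graph nA nB) (asg₁ : IsAssignment G P M₁) (asg₂ : IsAssignment G P M₂)
  (¬₁₂ : ¬ Blocks P M₁ M₂) (¬₂₁ : ¬ Blocks P M₂ M₁) where

  -- A student matched in `M₁` but not in `M₂` qualifies vacuously; `prefers₁⇒matched₂` later shows
  -- that this never happens.
  Prefers₁ : Fin nA → Set
  Prefers₁ a = ∃ λ b → M₁ ∋ (a , b) × ∀ b′ → M₂ ∋ (a , b′) → rankA P a b < rankA P a b′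

  Prefers₁? : Decidable Prefers₁
  Prefers₁? a = Fin.any? λ b → ∋? M₁ (a , b) ×-dec
    Fin.all? λ b′ → ∋? M₂ (a , b′) →-dec (rankA P a b <? rankA P a b′)

  prefers₁⇒< : ∀ {a b b′} → Prefers₁ a → M₁ ∋ (a , b) → M₂ ∋ (a , b′) → rankA P a b < rankA P a b′
  prefers₁⇒< {a} {b} {b′} (b₀ , m₀ , better) m₁ m₂ =
    subst (λ z → rankA P a z < rankA P a b′) (partner-unique G P M₁ asg₁ a b₀ b m₀ m₁) (better b′ m₂)

  M₂∌ : ∀ {a b} → Prefers₁ a → M₁ ∋ (a , b) → ¬ M₂ ∋ (a , b)
  M₂∌ pr m₁ m₂ = <-irrefl refl (prefers₁⇒< pr m₁ m₂)

  -- If `a` had no `M₁`-partner at least as good as `b`, the edge `ab` of `M₂` would block `M₁`. A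
  -- tie in rank would put `ab` into `M₁`.
  accepted⇒prefers₁ : ∀ {a b} → M₂ ∋ (a , b) → ¬ M₁ ∋ (a , b) →
    degB M₁ b < quotaB P b ⊎ (∃ λ a′ → M₁ ∋ (a′ , b) × rankB P b a < rankB P b a′) → Prefers₁ a
  accepted⇒prefers₁ {a} {b} m₂ ¬m₁ accepts
    with Fin.any? (λ b′ → ∋? M₁ (a , b′) ×-dec (rankA P a b′ ≤? rankA P a b))
  ... | no none = contradiction
    (a , b , m₂ , (λ b′ m → ≰⇒> (λ le → none (b′ , m , le))) , accepts) ¬₂₁
  ... | yes (b′ , m , le) = b′ , m , λ b″ m″ →
    subst (λ z → rankA P a b′ < rankA P a z) (partner-unique G P M₂ asg₂ a b b″ m₂ m″)
      (≤∧≢⇒< le λ eq → ¬m₁ (subst (λ z → M₁ ∋ (a , z))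
        (proj₁ wf a b′ b (proj₁ asg₁ a b′ m) (proj₁ asg₂ a b m₂) eq) m))

  rejected : ∀ {a b} → Prefers₁ a → M₁ ∋ (a , b) →
    ¬ (degB M₂ b < quotaB P b ⊎ ∃ λ a′ → M₂ ∋ (a′ , b) × rankB P b a < rankB P b a′)
  rejected {a} {b} pr m₁ accepts = ¬₁₂ (a , b , m₁ , (λ b′ → prefers₁⇒< pr m₁) , accepts)

  M₂-full : ∀ {a b} → Prefers₁ a → M₁ ∋ (a , b) → quotaB P b ≤ degB M₂ b
  M₂-full pr m₁ = ≮⇒≥ (rejected pr m₁ ∘ inj₁)

  M₂-better : ∀ {a a′ b} → Prefers₁ a → M₁ ∋ (a , b) → M₂ ∋ (a′ , b) → rankB P b a′ < rankB P b a
  M₂-better {a} {a′} {b} pr m₁ m₂ = ≤∧≢⇒<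
    (≮⇒≥ λ lt → rejected pr m₁ (inj₂ (a′ , m₂ , lt)))
    (λ eq → M₂∌ pr m₁ (subst (λ z → M₂ ∋ (z , b))
      (proj₁ (proj₂ wf) b a′ a (proj₁ asg₂ a′ b m₂) (proj₁ asg₁ a b m₁) eq) m₂))

  in₁ in₂ : Fin nA → Fin nB → Bool
  in₁ a b = entry M₁ (a , b)
  in₂ a b = entry M₂ (a , b)

  pref : Fin nA → Bool
  pref a = does (Prefers₁? a)

  ∧-pref : ∀ {m a} → m ≡ true → Prefers₁ a → m ∧ pref a ≡ true
  ∧-pref refl pr = dec-true (Prefers₁? _) pr

  ∧-pref⁻ : ∀ {m a} → m ∧ pref a ≡ true → m ≡ true × Prefers₁ a
  ∧-pref⁻ {true} {a} eq with yes pr ← Prefers₁? a = refl , pr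

  ∧-¬pref : ∀ {m a} → m ≡ true → ¬ Prefers₁ a → m ∧ not (pref a) ≡ true
  ∧-¬pref refl ¬pr = cong not (dec-false (Prefers₁? _) ¬pr)

  ∧-¬pref⁻ : ∀ {m a} → m ∧ not (pref a) ≡ true → m ≡ true × ¬ Prefers₁ a
  ∧-¬pref⁻ {true} {a} eq with no ¬pr ← Prefers₁? a = refl , ¬pr

  col₁ col₂ rest₁ rest₂ : Fin nB → ℕ
  col₁  b = count λ a → in₁ a b ∧ pref a
  col₂  b = count λ a → in₂ a b ∧ pref a
  rest₁ b = count λ a → in₁ a b ∧ not (pref a)
  rest₂ b = count λ a → in₂ a b ∧ not (pref a)

  -- In `M₁` the school `b` holds `a₀`, whom it ranks below all its `M₂`-students. It would thus
  -- accept in `M₁` any `M₂`-student it lacks there, and that student would have to prefer `M₁`.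
  rest₂⊆rest₁ : ∀ {a₀ b} → Prefers₁ a₀ → M₁ ∋ (a₀ , b) →
    ∀ a → ind (in₂ a b ∧ not (pref a)) ≤ ind (in₁ a b ∧ not (pref a))
  rest₂⊆rest₁ {a₀} {b} pr₀ m₀ a = ind-mono λ eq →
    let m₂ , ¬pr = ∧-¬pref⁻ eq in
    case ∋? M₁ (a , b) of λ where
      (yes m₁) → ∧-¬pref m₁ ¬pr
      (no ¬m₁) → contradiction (accepted⇒prefers₁ m₂ ¬m₁ (inj₂ (a₀ , m₀ , M₂-better pr₀ m₀ m₂))) ¬pr

  total-≤ : ∀ {a₀ b} → Prefers₁ a₀ → M₁ ∋ (a₀ , b) → col₁ b + rest₁ b ≤ col₂ b + rest₂ b
  total-≤ {_} {b} pr₀ m₀ = begin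
    col₁ b + rest₁ b          ≡⟨ count-split (λ a → in₁ a b) pref ⟨
    count (λ a → in₁ a b)     ≡⟨ degB≡count M₁ b ⟨
    degB M₁ b                 ≤⟨ proj₂ (proj₂ asg₁) b ⟩
    quotaB P b                ≤⟨ M₂-full pr₀ m₀ ⟩
    degB M₂ b                 ≡⟨ degB≡count M₂ b ⟩
    count (λ a → in₂ a b)     ≡⟨ count-split (λ a → in₂ a b) pref ⟩
    col₂ b + rest₂ b          ∎
    where open ≤-Reasoning

  -- When `col₁ b` is positive, `b` is full in `M₂`, so it has at least as many students there as in
  -- `M₁`. Outside the preferring students `M₂` gives no more than `M₁`, so the surplus lies among
  -- them.
  col-≤ : ∀ b → col₁ b ≤ col₂ b
  col-≤ b with 1 ≤? col₁ b
  ... | no ≱1 = ≤-trans (≤-pred (≰⇒> ≱1)) z≤n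
  ... | yes ≥1 with a₀ , eq ← ∃-count (λ a → in₁ a b ∧ pref a) ≥1 with m₀ , pr₀ ← ∧-pref⁻ eq =
    +-cancelʳ-≤ (rest₂ b) _ _ (≤-trans (+-monoʳ-≤ (col₁ b) (sum-mono-≤ (rest₂⊆rest₁ pr₀ m₀))) (total-≤ pr₀ m₀))

  row-≤ : ∀ a → count (λ b → in₂ a b ∧ pref a) ≤ count (λ b → in₁ a b ∧ pref a)
  row-≤ a with 1 ≤? count (λ b → in₂ a b ∧ pref a)
  ... | no ≱1 = ≤-trans (≤-pred (≰⇒> ≱1)) z≤n
  ... | yes ≥1 with b₂ , eq ← ∃-count (λ b → in₂ a b ∧ pref a) ≥1 with m₂ , pr@(b₁ , m₁ , _) ← ∧-pref⁻ {a = a} eq = begin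
    count (λ b → in₂ a b ∧ pref a)  ≤⟨ count-mono _ (in₂ a) (λ b → proj₁ ∘ ∧-pref⁻ {a = a}) ⟩
    count (in₂ a)                   ≡⟨ degA≡count M₂ a ⟨
    degA M₂ a                       ≤⟨ proj₁ (proj₂ asg₂) a ⟩
    1                               ≤⟨ count-∃ (λ b → in₁ a b ∧ pref a) b₁ (∧-pref m₁ pr) ⟩
    count (λ b → in₁ a b ∧ pref a)  ∎
    where open ≤-Reasoning

  row-≡ : ∀ a → count (λ b → in₂ a b ∧ pref a) ≡ count (λ b → in₁ a b ∧ pref a)
  row-≡ = proj₁ (double-counting (λ a b → ind (in₁ a b ∧ pref a)) (λ a b → ind (in₂ a b ∧ pref a)) row-≤ col-≤)

  col-≡ : ∀ b → col₁ b ≡ col₂ b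
  col-≡ = proj₂ (double-counting (λ a b → ind (in₁ a b ∧ pref a)) (λ a b → ind (in₂ a b ∧ pref a)) row-≤ col-≤)

  prefers₁⇒matched₂ : ∀ {a} → Prefers₁ a → ∃ λ b → M₂ ∋ (a , b)
  prefers₁⇒matched₂ {a} pr@(b₁ , m₁ , _)
    with b₂ , eq ← ∃-count (λ b → in₂ a b ∧ pref a) (subst (1 ≤_) (sym (row-≡ a)) (count-∃ (λ b → in₁ a b ∧ pref a) b₁ (∧-pref m₁ pr))) =
    b₂ , proj₁ (∧-pref⁻ {a = a} eq)

  prefers₁-exchange : ∀ {a b} → Prefers₁ a → M₂ ∋ (a , b) → ∃ λ a₁ → Prefers₁ a₁ × M₁ ∋ (a₁ , b)
  prefers₁-exchange {a} {b} pr m₂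
    with a₁ , eq ← ∃-count (λ a → in₁ a b ∧ pref a) (subst (1 ≤_) (sym (col-≡ b)) (count-∃ (λ a → in₂ a b ∧ pref a) a (∧-pref m₂ pr)))
    with m₁ , pr₁ ← ∧-pref⁻ eq = a₁ , pr₁ , m₁

  rest-≤ : ∀ {a b} → Prefers₁ a → M₁ ∋ (a , b) → rest₁ b ≤ rest₂ b
  rest-≤ {a} {b} pr m₁ = +-cancelˡ-≤ (col₁ b) _ _
    (subst (λ z → col₁ b + rest₁ b ≤ z + rest₂ b) (sym (col-≡ b)) (total-≤ pr m₁))

  -- The rural hospitals argument: the exchange supplies a preferring `M₁`-student of `b`, so `b` is
  -- full in `M₂`, and comparing the two parts of its column carries fullness over to `M₁`.
  M₁-full : ∀ {a b} → Prefers₁ a → M₂ ∋ (a , b) → quotaB P b ≤ degB M₁ b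
  M₁-full {a} {b} pr m₂ with a₁ , pr₁ , m₁ ← prefers₁-exchange pr m₂ = begin
    quotaB P b                ≤⟨ M₂-full pr₁ m₁ ⟩
    degB M₂ b                 ≡⟨ degB≡count M₂ b ⟩
    count (λ a → in₂ a b)     ≡⟨ count-split (λ a → in₂ a b) pref ⟩
    col₂ b + rest₂ b          ≤⟨ +-mono-≤ (≤-reflexive (sym (col-≡ b))) (sum-mono-≤ (rest₂⊆rest₁ pr₁ m₁)) ⟩
    col₁ b + rest₁ b          ≡⟨ count-split (λ a → in₁ a b) pref ⟨
    count (λ a → in₁ a b)     ≡⟨ degB≡count M₁ b ⟨
    degB M₁ b                 ∎
    where open ≤-Reasoning

  -- Tightness of the column makes the non-preferring students of `b` the same in both assignments.
  -- If the worst `M₁`-student were one of them, it would also be in `M₂` at `b` and hence rank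
  -- above `a₁`, against being worst.
  worst-prefers₁ : ∀ {a₀ a b} → Prefers₁ a₀ → M₂ ∋ (a₀ , b) → M₁ ∋ (a , b) →
    (∀ a′ → M₁ ∋ (a′ , b) → rankB P b a′ ≤ rankB P b a) → Prefers₁ a
  worst-prefers₁ {a₀} {a} {b} pr₀ m₂ m₁ worst
    with a₁ , pr₁ , m₁₁ ← prefers₁-exchange pr₀ m₂
    with Prefers₁? a
  ... | yes pr = pr
  ... | no ¬pr = contradiction (worst a₁ m₁₁) (<⇒≱ (M₂-better pr₁ m₁₁ m₂a))
    where
    m₂a : M₂ ∋ (a , b)
    m₂a = proj₁ (∧-¬pref⁻ {a = a} (ind-injective
      (sym (sum-squeeze (rest₂⊆rest₁ pr₁ m₁₁) (rest-≤ pr₁ m₁₁) a)) (∧-¬pref m₁ ¬pr)))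

-- Rotations, uniformly in the side X

module _ {nA nB : ℕ} where

  Vtx : Side → Set
  Vtx = V {nA} {nB}

  _≟V_ : ∀ {X} (u v : Vtx X) → Dec (u ≡ v)
  _≟V_ {A} = Fin._≟_
  _≟V_ {B} = Fin._≟_

  any?V : ∀ X {Q : Vtx X → Set} → Decidable Q → Dec (∃ Q)
  any?V A = Fin.any?
  any?V B = Fin.any?

  sumV : ∀ X → (Vtx X → ℕ) → ℕ
  sumV A = sum
  sumV B = sum

  sumV-mono-≤ : ∀ X {f g : Vtx X → ℕ} → (∀ v → f v ≤ g v) → sumV X f ≤ sumV X g
  sumV-mono-≤ A = sum-mono-≤
  sumV-mono-≤ B = sum-mono-≤

  sumV-mono-< : ∀ X {f g : Vtx X → ℕ} → (∀ v → f v ≤ g v) → ∀ v → f v < g v → sumV X f < sumV X g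
  sumV-mono-< A = sum-mono-<
  sumV-mono-< B = sum-mono-<

  sumV-cong : ∀ X {f g : Vtx X → ℕ} → (∀ v → f v ≡ g v) → sumV X f ≡ sumV X g
  sumV-cong A = sum-cong-≗
  sumV-cong B = sum-cong-≗

  weightV : ∀ X → (Vtx X → ℕ) → (Vtx X → Bool) → ℕ
  weightV X w p = sumV X (λ v → ind (p v) * w v)

  countV : ∀ X → (Vtx X → Bool) → ℕ
  countV X p = sumV X (λ v → ind (p v))

  weightV-swap : ∀ X (w : Vtx X → ℕ) {p p′ : Vtx X → Bool} {u v} → Swap p p′ u v →
    weightV X w p′ + w u ≡ weightV X w p + w v
  weightV-swap A = weight-swap
  weightV-swap B = weight-swap

  countV-swap : ∀ X {p p′ : Vtx X → Bool} {u v} → Swap p p′ u v → countV X p′ ≡ countV X p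
  countV-swap A = count-swap
  countV-swap B = count-swap

  countTrue-allV : ∀ X (p : Vtx X → Bool) → countTrue (map p (allV X)) ≡ countV X p
  countTrue-allV A = countTrue-allFin
  countTrue-allV B = countTrue-allFin

  edge-injective : ∀ X {x x′ : Vtx X} {y y′ : Vtx (other X)} → edge X x y ≡ edge X x′ y′ → x ≡ x′ × y ≡ y′
  edge-injective A refl = refl , refl
  edge-injective B refl = refl , refl

  on-edges : ∀ X {Q : Fin nA × Fin nB → Set} → (∀ a b → Q (a , b)) → ∀ x y → Q (edge X x y)
  on-edges A q x y = q x y
  on-edges B q x y = q y x

  from-edges : ∀ X {Q : Fin nA × Fin nB → Set} → (∀ x y → Q (edge X x y)) → ∀ a b → Q (a , b)
  from-edges A q a b = q a b
  from-edges B q a b = q b a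

  quotaX : Prefs nA nB → (X : Side) → Vtx X → ℕ
  quotaX P A = λ _ → 1
  quotaX P B = quotaB P

  degX : Graph nA nB → (X : Side) → Vtx X → ℕ
  degX M X x = countTrue (map (λ y → entry M (edge X x y)) (allV (other X)))

  AcceptsX AcceptsY : Prefs nA nB → Graph nA nB → (X : Side) → Vtx X → Vtx (other X) → Set
  AcceptsX P M X x y =
    degX M X x < quotaX P X x ⊎ ∃ λ y′ → M ∋ edge X x y′ × rankX P X x y < rankX P X x y′
  AcceptsY P M X x y =
    degY M X y < quotaY P X y ⊎ ∃ λ x′ → M ∋ edge X x′ y × rankY P X y x < rankY P X y x′

  -- A form of blocking that treats both sides alike, so that rotations are analysed once for both
  -- values of `X`. For students the quota is 1, and being matched to `y` already is excluded
  -- explicitly.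
  SymBlocks : Prefs nA nB → Graph nA nB → (X : Side) → Vtx X → Vtx (other X) → Set
  SymBlocks P M X x y = ¬ M ∋ edge X x y × AcceptsX P M X x y × AcceptsY P M X x y

  -- Pairs whose Y-end is undersubscribed are exempt: s_M ignores them, so they may block M/ρ.
  -- By the rural hospitals theorem they are not legal edges (unless already in M).
  FullStable : Graph nA nB → Prefs nA nB → Side → Graph nA nB → Set
  FullStable H P X M = ∀ x y → H ∋ edge X x y → degY M X y ≡ quotaY P X y → ¬ SymBlocks P M X x y

  YAssignment : Graph nA nB → Prefs nA nB → Side → Graph nA nB → Set
  YAssignment H P X M =
    (∀ x y → M ∋ edge X x y → H ∋ edge X x y) ×
    (∀ x → degX M X x ≤ quotaX P X x) × (∀ y → degY M X y ≤ quotaY P X y)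

  to-YAssignment : ∀ X H P M → IsAssignment H P M → YAssignment H P X M
  to-YAssignment A H P M (⊆H , ≤A , ≤B) = ⊆H , ≤A , ≤B
  to-YAssignment B H P M (⊆H , ≤A , ≤B) = (λ b a → ⊆H a b) , ≤B , ≤A

  from-YAssignment : ∀ X H P M → YAssignment H P X M → IsAssignment H P M
  from-YAssignment A H P M (⊆H , ≤A , ≤B) = ⊆H , ≤A , ≤B
  from-YAssignment B H P M (⊆H , ≤B , ≤A) = (λ a b → ⊆H b a) , ≤A , ≤B

  -- Equivalence of the two forms of blocking

  module StudentAcceptance (G : Graph nA nB) (P : Prefs nA nB) (M : Graph nA nB) (asg : IsAssignment G P M) where

    Wants Wants′ : Fin nA → Fin nB → Set
    Wants a b = ∀ b′ → M ∋ (a , b′) → rankA P a b < rankA P a b′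
    Wants′ a b = degA M a < 1 ⊎ ∃ λ b′ → M ∋ (a , b′) × rankA P a b < rankA P a b′

    wants⇒ : ∀ {a b} → Wants a b → Wants′ a b
    wants⇒ {a} {b} w with degA M a <? 1
    ... | yes <1 = inj₁ <1
    ... | no ≮1 with b′ , m ← ∃-count (λ b → entry M (a , b)) (subst (1 ≤_) (degA≡count M a) (≮⇒≥ ≮1)) =
      inj₂ (b′ , m , w b′ m)

    wants⇐ : ∀ {a b} → Wants′ a b → Wants a b
    wants⇐ {a} {b} (inj₁ <1) b′ m = contradiction
      (subst (1 ≤_) (sym (degA≡count M a)) (count-∃ (λ b → entry M (a , b)) b′ m)) (<⇒≱ <1)
    wants⇐ {a} {b} (inj₂ (b″ , m″ , lt)) b′ m =
      subst (λ z → rankA P a b < rankA P a z) (partner-unique G P M asg a b″ b′ m″ m) lt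

    wants⇒∉ : ∀ {a b} → Wants a b → ¬ M ∋ (a , b)
    wants⇒∉ {a} {b} w m = <-irrefl refl (w b m)

    sym⇒edge : ∀ X x y → SymBlocks P M X x y →
      EdgeBlocks P M (proj₁ (edge X x y)) (proj₂ (edge X x y))
    sym⇒edge A a b (_ , acA , acB) = wants⇐ acA , acB
    sym⇒edge B b a (_ , acB , acA) = wants⇐ acA , acB

    edge⇒sym : ∀ X x y → EdgeBlocks P M (proj₁ (edge X x y)) (proj₂ (edge X x y)) → SymBlocks P M X x y
    edge⇒sym A a b (w , acB) = wants⇒∉ w , wants⇒ w , acB
    edge⇒sym B b a (w , acB) = wants⇒∉ w , acB , wants⇒ w

  rankSum : Prefs nA nB → (X : Side) → Graph nA nB → Vtx (other X) → ℕ
  rankSum P X M y = weightV X (rankY P X y) (λ x → entry M (edge X x y))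

  -- Effect of a rotation on degrees, ranks and stability

  module Rotate {H P X} {M M′ : Graph nA nB} (ρ : Rotation H P M X) (rot : RotatedBy ρ M′) where
    open Rotation ρ

    lost gained : Fin (suc r-1) → Fin nA × Fin nB
    lost   i = edge X (xs i) (ys i)
    gained i = edge X (xs i) (ys (sucMod i))

    rot∋ : ∀ x y → M′ ∋ edge X x y ⇔
      ((M ∋ edge X x y × (∀ i → lost i ≢ edge X x y)) ⊎ (∃ λ i → gained i ≡ edge X x y))
    rot∋ = on-edges X rot

    next : ∀ i → NextOf P M X (ys i) (xN (xs i))
    next i with k , refl ← sucMod-surjective i = proj₂ (arcYX k)

    lost∈M : ∀ i → M ∋ lost i
    lost∈M i = proj₁ (proj₂ (next i))

    worst : ∀ i x → M ∋ edge X x (ys i) → rankY P X (ys i) x ≤ rankY P X (ys i) (xs i)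
    worst i = proj₂ (proj₂ (next i))

    gained∉M : ∀ i → ¬ M ∋ gained i
    gained∉M i = proj₁ (proj₂ (proj₁ (arcXY i)))

    gained∈H : ∀ i → H ∋ gained i
    gained∈H i = proj₁ (proj₁ (arcXY i))

    -- Being a candidate only says that some partner of the next `y` is worse than `xs i`; the
    -- partner given up there is the worst one.
    improves : ∀ i → rankY P X (ys (sucMod i)) (xs i) < rankY P X (ys (sucMod i)) (xs (sucMod i))
    improves i with _ , _ , x , m , lt ← proj₁ (arcXY i) = <-≤-trans lt (worst (sucMod i) x m)

    gained∈M′ : ∀ i → M′ ∋ gained i
    gained∈M′ i = Equivalence.from (rot∋ _ _) (inj₂ (i , refl))

    lost∉M′ : ∀ i → ¬ M′ ∋ lost i
    lost∉M′ i m with Equivalence.to (rot∋ _ _) m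
    ... | inj₁ (_ , ¬lost) = ¬lost i refl
    ... | inj₂ (j , eq) = gained∉M j (subst (M ∋_) (sym eq) (lost∈M i))

    unchanged : ∀ x y → (∀ i → lost i ≢ edge X x y) → (∀ i → gained i ≢ edge X x y) →
      entry M′ (edge X x y) ≡ entry M (edge X x y)
    unchanged x y ¬lost ¬gained = Bool.⇔→≡ (mk⇔
      (λ m′ → case Equivalence.to (rot∋ x y) m′ of λ where
        (inj₁ (m , _)) → m
        (inj₂ (i , eq)) → contradiction eq (¬gained i))
      (λ m → Equivalence.from (rot∋ x y) (inj₁ (m , ¬lost))))

    new-edge : ∀ x y → M′ ∋ edge X x y →
      M ∋ edge X x y ⊎ ∃ λ i → xs i ≡ x × ys (sucMod i) ≡ y
    new-edge x y m′ with Equivalence.to (rot∋ x y) m′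
    ... | inj₁ (m , _) = inj₁ m
    ... | inj₂ (i , eq) = inj₂ (i , edge-injective X eq)

    old-edge : ∀ x y → M ∋ edge X x y → ¬ M′ ∋ edge X x y → ∃ λ i → xs i ≡ x × ys i ≡ y
    old-edge x y m ¬m′ with Fin.any? (λ i → (xs i ≟V x) ×-dec (ys i ≟V y))
    ... | yes found = found
    ... | no none = contradiction
      (Equivalence.from (rot∋ x y) (inj₁ (m , λ i eq → none (i , edge-injective X eq)))) ¬m′

    -- As the vertices of the cycle are distinct, only the index `i` touches this row; likewise for
    -- the column in `swapY`.
    swapX : ∀ i → Swap (λ y → entry M (edge X (xs i) y)) (λ y → entry M′ (edge X (xs i) y))
                       (ys i) (ys (sucMod i))
    swapX i = record
      { p-u  = lost∈M i
      ; p-v  = Bool.¬-not (gained∉M i)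
      ; p′-u = Bool.¬-not (lost∉M′ i)
      ; p′-v = gained∈M′ i
      ; rest = λ y ≢u ≢v → unchanged (xs i) y
          (λ j eq → let xeq , yeq = edge-injective X eq in
            ≢u (trans (sym yeq) (cong ys (xs-inj xeq))))
          (λ j eq → let xeq , yeq = edge-injective X eq in
            ≢v (trans (sym yeq) (cong (ys ∘ sucMod) (xs-inj xeq))))
      }

    swapY : ∀ i → Swap (λ x → entry M (edge X x (ys (sucMod i)))) (λ x → entry M′ (edge X x (ys (sucMod i))))
                       (xs (sucMod i)) (xs i)
    swapY i = record
      { p-u  = lost∈M (sucMod i)
      ; p-v  = Bool.¬-not (gained∉M i)
      ; p′-u = Bool.¬-not (lost∉M′ (sucMod i))
      ; p′-v = gained∈M′ i
      ; rest = λ x ≢u ≢v → unchanged x (ys (sucMod i))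
          (λ j eq → let xeq , yeq = edge-injective X eq in
            ≢u (trans (sym xeq) (cong xs (ys-inj yeq))))
          (λ j eq → let xeq , yeq = edge-injective X eq in
            ≢v (trans (sym xeq) (cong xs (sucMod-injective (ys-inj yeq)))))
      }

    data InYs (y : Vtx (other X)) : Set where
      hit  : ∀ i → ys (sucMod i) ≡ y → InYs y
      miss : (∀ i → ys i ≢ y) → InYs y

    inYs? : ∀ y → InYs y
    inYs? y with Fin.any? (λ i → ys i ≟V y)
    ... | no none = miss (λ i eq → none (i , eq))
    ... | yes (i , eq) with k , refl ← sucMod-surjective i = hit k eq

    off-ys : ∀ {y} → (∀ i → ys i ≢ y) → ∀ x → entry M′ (edge X x y) ≡ entry M (edge X x y)
    off-ys {y} none x = unchanged x y (λ i eq → none i (proj₂ (edge-injective X eq)))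
                                      (λ i eq → none (sucMod i) (proj₂ (edge-injective X eq)))

    degY-≡ : ∀ y → degY M′ X y ≡ degY M X y
    degY-≡ y = trans (countTrue-allV X _) (trans eq (sym (countTrue-allV X _)))
      where
      eq : countV X (λ x → entry M′ (edge X x y)) ≡ countV X (λ x → entry M (edge X x y))
      eq with inYs? y
      ... | hit i refl = countV-swap X (swapY i)
      ... | miss none  = sumV-cong X (λ x → cong ind (off-ys none x))

    degX-≡ : ∀ x → degX M′ X x ≡ degX M X x
    degX-≡ x = trans (countTrue-allV (other X) _) (trans eq (sym (countTrue-allV (other X) _)))
      where
      eq : countV (other X) (λ y → entry M′ (edge X x y)) ≡ countV (other X) (λ y → entry M (edge X x y))
      eq with Fin.any? (λ i → xs i ≟V x)
      ... | yes (i , refl) = countV-swap (other X) (swapX i)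
      ... | no none = sumV-cong (other X) λ y → cong ind (unchanged x y
            (λ i eq → none (i , proj₁ (edge-injective X eq))) (λ i eq → none (i , proj₁ (edge-injective X eq))))

    rankSum-< : ∀ i → rankSum P X M′ (ys (sucMod i)) < rankSum P X M (ys (sucMod i))
    rankSum-< i = +-cancelʳ-< (rankY P X y (xs (sucMod i))) _ _
      (subst (_< rankSum P X M y + rankY P X y (xs (sucMod i)))
        (sym (weightV-swap X (rankY P X y) (swapY i)))
        (+-monoʳ-< (rankSum P X M y) (improves i)))
      where
      y : Vtx (other X)
      y = ys (sucMod i)

    rankSum-≤ : ∀ y → rankSum P X M′ y ≤ rankSum P X M y
    rankSum-≤ y with inYs? y
    ... | hit i refl = <⇒≤ (rankSum-< i)
    ... | miss none  = ≤-reflexive (sumV-cong X (λ x → cong (λ e → ind e * rankY P X y x) (off-ys none x)))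

    rotated-YAssignment : YAssignment H P X M → YAssignment H P X M′
    rotated-YAssignment (⊆H , ≤X , ≤Y) =
      (λ x y m′ → case new-edge x y m′ of λ where
        (inj₁ m) → ⊆H x y m
        (inj₂ (i , refl , refl)) → gained∈H i) ,
      (λ x → subst (_≤ quotaX P X x) (sym (degX-≡ x)) (≤X x)) ,
      (λ y → subst (_≤ quotaY P X y) (sym (degY-≡ y)) (≤Y y))

    rotated-underfull : ∀ x y → degY M X y < quotaY P X y → M ∋ edge X x y → M′ ∋ edge X x y
    rotated-underfull x y <q m with ∋? M′ (edge X x y)
    ... | yes m′ = m′
    ... | no ¬m′ with i , refl , refl ← old-edge x y m ¬m′ = contradiction (proj₁ (next i)) (<⇒≢ <q)

    -- A pair blocking after the rotation would block before it. The full `y` has only improved, so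
    -- it already accepted `x`. If `x` preferred `y` to a newly gained partner, `y` would be a
    -- candidate better than `s_M(x)`. If `xy` was just given up, `x` was the worst partner of `y`,
    -- so `y` cannot want it back.
    rotated-FullStable : FullStable H P X M → FullStable H P X M′
    rotated-FullStable fs x y h full′ (∉M′ , acX′ , acY′) = fs x y h full (∉M , acX acX′ , inj₂ (better acY′))
      where
      full : degY M X y ≡ quotaY P X y
      full = trans (sym (degY-≡ y)) full′
      better : AcceptsY P M′ X x y → ∃ λ x′ → M ∋ edge X x′ y × rankY P X y x < rankY P X y x′
      better (inj₁ <q) = contradiction full′ (<⇒≢ <q)
      better (inj₂ (x′ , m′ , lt)) with new-edge x′ y m′
      ... | inj₁ m = x′ , m , lt
      ... | inj₂ (i , refl , refl) = xs (sucMod i) , lost∈M (sucMod i) , <-trans lt (improves i)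
      ∉M : ¬ M ∋ edge X x y
      ∉M m with i , refl , refl ← old-edge x y m ∉M′ with x′ , m′ , lt ← better acY′ =
        contradiction lt (≤⇒≯ (worst i x′ m′))
      acX : AcceptsX P M′ X x y → AcceptsX P M X x y
      acX (inj₁ <q) = inj₁ (subst (_< quotaX P X x) (degX-≡ x) <q)
      acX (inj₂ (y′ , m′ , lt)) with new-edge x y′ m′
      ... | inj₁ m = inj₂ (y′ , m , lt)
      ... | inj₂ (i , refl , refl) = contradiction lt (≤⇒≯ (proj₂ (arcXY i) y (h , ∉M , better acY′)))

-- Termination

module _ {nA nB : ℕ} where

  edgeCount : (X : Side) → Graph nA nB → Vtx {nA} {nB} (other X) → ℕ
  edgeCount X H y = countV X (λ x → entry H (edge X x y))

  measure : Prefs nA nB → Side → State → ℕ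
  measure P X (H , M) = sumV (other X) (edgeCount X H) + sumV (other X) (rankSum P X M)

  step-decreases : ∀ {P X s s′} → Step {nA} {nB} P X s s′ → measure P X s′ < measure P X s
  step-decreases {P} {X} (case-i {H} {M} {H′} x′ y n (cand , _) _ _ removed) =
    +-monoˡ-< (sumV (other X) (rankSum P X M))
      (sumV-mono-< (other X) (λ y → sumV-mono-≤ X (λ x → H′≤H x y)) y
        (sumV-mono-< X (λ x → H′≤H x y) x′ H′<H))
    where
    H′∋ : ∀ x y → H′ ∋ edge X x y ⇔ (H ∋ edge X x y × edge X x′ _ ≢ edge X x y)
    H′∋ = on-edges X removed
    H′≤H : ∀ x y → ind (entry H′ (edge X x y)) ≤ ind (entry H (edge X x y))
    H′≤H x y = ind-mono (proj₁ ∘ Equivalence.to (H′∋ x y))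
    H′<H : ind (entry H′ (edge X x′ y)) < ind (entry H (edge X x′ y))
    H′<H rewrite proj₁ cand
               | Bool.¬-not (λ h′ → proj₂ (Equivalence.to (H′∋ x′ y) h′) refl) = ≤-refl
  step-decreases {P} {X} (case-ii {H} {M} {M′} ρ rot) =
    +-monoʳ-< (sumV (other X) (edgeCount X H)) (sumV-mono-< (other X) rankSum-≤ _ (rankSum-< zero))
    where open Rotate {M′ = M′} ρ rot

  steps-terminate : ∀ P X s → Acc (λ s′ s → Step {nA} {nB} P X s s′) s
  steps-terminate P X s = Subrelation.accessible step-decreases
    (On.accessible (measure P X) (<-wellFounded (measure P X s)))

  -- Progress

  extremumV : ∀ X {_≼_ : ℕ → ℕ → Set} → Total _≼_ → Transitive _≼_ →
    {Q : Vtx {nA} {nB} X → Set} → Decidable Q → (f : Vtx X → ℕ) → ∃ Q →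
    ∃ λ v → Q v × ∀ v′ → Q v′ → f v ≼ f v′
  extremumV A = extremum
  extremumV B = extremum

  finite-choiceV : ∀ X {C : Set} {Q : Vtx {nA} {nB} X → Set} → (∀ v → C ⊎ Q v) → C ⊎ (∀ v → Q v)
  finite-choiceV A = finite-choice
  finite-choiceV B = finite-choice

  cycleV : ∀ X (f : Vtx {nA} {nB} X → Vtx X) (Q : Vtx X → Set) → (∀ {x} → Q x → Q (f x)) → ∀ x₀ → Q x₀ →
    ∃ λ r → Σ (Fin (suc r) → Vtx X) λ c →
      Injective _≡_ _≡_ c × (∀ t → c (sucMod t) ≡ f (c t)) × (∀ t → Q (c t))
  cycleV A = cycle
  cycleV B = cycle

  -- Realises a decidable relation as a Boolean matrix; the successor states are specified only
  -- through their edges, so their existence needs this.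
  graphOf : {Q : Fin nA → Fin nB → Set} → (∀ a b → Dec (Q a b)) →
    Σ (Graph nA nB) λ K → ∀ a b → K ∋ (a , b) ⇔ Q a b
  graphOf {Q} Q? = K , λ a b → mk⇔ (to a b) (from a b)
    where
    K : Graph nA nB
    K = Vec.tabulate λ a → Vec.tabulate λ b → does (Q? a b)
    entry-K : ∀ a b → entry K (a , b) ≡ does (Q? a b)
    entry-K a b = trans (cong (λ v → Vec.lookup v b) (lookup∘tabulate _ a)) (lookup∘tabulate _ b)
    to : ∀ a b → K ∋ (a , b) → Q a b
    to a b k with yes q ← Q? a b | eq ← trans (sym (entry-K a b)) k = q
    from : ∀ a b → Q a b → K ∋ (a , b)
    from a b q = trans (entry-K a b) (dec-true (Q? a b) q)

  module _ (H : Graph nA nB) (P : Prefs nA nB) (M : Graph nA nB) (X : Side) where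

    Cand? : ∀ x y → Dec (Cand H P M X x y)
    Cand? x y = ∋? H (edge X x y) ×-dec ¬? (∋? M (edge X x y)) ×-dec
      any?V X (λ x′ → ∋? M (edge X x′ y) ×-dec (rankY P X y x <? rankY P X y x′))

    best-candidate : ∀ x → ∃ (Cand H P M X x) → ∃ (IsS H P M X x)
    best-candidate x = extremumV (other X) ≤-total ≤-trans (Cand? x) (rankX P X x)

    sink : ∀ {x} → ¬ ∃ (Cand H P M X x) → Sink H P M X (xN x)
    sink none (yN y) (cand , _) = none (y , cand)

    next-exists : (∀ y → degY M X y ≤ quotaY P X y) → ∀ x y → Cand H P M X x y → ∃ (NextOf P M X y)
    next-exists ≤q x y (_ , _ , x′ , m , _) with m≤n⇒m<n∨m≡n (≤q y)
    ... | inj₁ <q = ∅N , <q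
    -- The order is reversed: the largest rank is the least preferred partner.
    ... | inj₂ ≡q with w , mw , worst ← extremumV X (λ m n → ≤-total n m) (λ p q → ≤-trans q p)
                          (λ x → ∋? M (edge X x y)) (rankY P X y) (x′ , m) =
      xN w , ≡q , mw , worst

    removeEdge : ∀ e → ∃ (RemovedEdge H e)
    removeEdge e = graphOf λ a b → ∋? H (a , b) ×-dec ¬? (≡-dec Fin._≟_ Fin._≟_ e (a , b))

    rotate : (ρ : Rotation H P M X) → ∃ (RotatedBy ρ)
    rotate ρ = graphOf λ a b →
      (∋? M (a , b) ×-dec Fin.all? (λ i → ¬? (≡-dec Fin._≟_ Fin._≟_ (edge X (xs i) (ys i)) (a , b)))) ⊎-dec
      Fin.any? (λ i → ≡-dec Fin._≟_ Fin._≟_ (edge X (xs i) (ys (sucMod i))) (a , b))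
      where open Rotation ρ

    remove : ∀ x y n → IsS H P M X x y → NextOf P M X y n → Sink H P M X n → ∃ (Step P X (H , M))
    remove x y n isS nxt snk with H′ , removed ← removeEdge (edge X x y) =
      (H′ , M) , case-i x y n isS ((x , isS) , nxt) snk removed

    HasCand : Vtx X → Set
    HasCand x = ∃ (Cand H P M X x)

    Continues : Vtx X → Set
    Continues x = ¬ HasCand x ⊎ ∃ λ x′ → HasCand x′ × ∃ λ y → IsS H P M X x y × NextOf P M X y (xN x′)

    module _ (≤q : ∀ y → degY M X y ≤ quotaY P X y)
      (rank-injective : ∀ y x x′ → M ∋ edge X x y → M ∋ edge X x′ y →
        rankY P X y x ≡ rankY P X y x′ → x ≡ x′) where

      -- If the vertex after `s(x)` is `∅N` or has no candidate, it is a sink and a removal applies.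
      -- Otherwise the walk goes on from a vertex that again has a candidate.
      follow : ∀ x → ∃ (Step P X (H , M)) ⊎ Continues x
      follow x with any?V (other X) (Cand? x)
      ... | no none = inj₂ (inj₁ none)
      ... | yes has with y , isS ← best-candidate x has with next-exists ≤q x y (proj₁ isS)
      ... | ∅N , nxt = inj₁ (remove x y ∅N isS nxt λ _ ())
      ... | xN x′ , nxt with any?V (other X) (Cand? x′)
      ... | no none = inj₁ (remove x y (xN x′) isS nxt (sink none))
      ... | yes has′ = inj₂ (inj₂ (x′ , has′ , y , isS , nxt))

      next-unique : ∀ y x x′ → NextOf P M X y (xN x) → NextOf P M X y (xN x′) → x ≡ x′
      next-unique y x x′ (_ , m , worst) (_ , m′ , worst′) =
        rank-injective y x x′ m m′ (≤-antisym (worst′ x m) (worst x′ m′))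

      module _ (continues : ∀ x → Continues x) where

        succ : Vtx X → Vtx X
        succ x with continues x
        -- A default to make the map total; the cycle stays among vertices with candidates, where
        -- this branch is impossible.
        ... | inj₁ _        = x
        ... | inj₂ (x′ , _) = x′

        via : ∀ {x} → HasCand x → ∃ λ y → IsS H P M X x y × NextOf P M X y (xN (succ x))
        via {x} has with continues x
        ... | inj₁ none             = contradiction has none
        ... | inj₂ (_ , _ , arcs) = arcs

        succ-has : ∀ {x} → HasCand x → HasCand (succ x)
        succ-has {x} has with continues x
        ... | inj₁ _              = has
        ... | inj₂ (_ , has′ , _) = has′

        rotation : ∀ x → HasCand x → Rotation H P M X
        rotation x has with r , c , c-inj , c-suc , c-has ← cycleV X succ HasCand succ-has x has = record
          { r-1    = r
          ; xs     = xs
          ; ys     = ys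
          ; xs-inj = xs-inj
          -- The next vertex depends on `y` alone, so equal `ys` force equal `xs`.
          ; ys-inj = λ {i} {j} eq → xs-inj (next-unique (ys j) (xs i) (xs j)
                       (subst (λ y → NextOf P M X y (xN (xs i))) eq (nxt i)) (nxt j))
          ; arcXY  = isS
          ; arcYX  = λ i → (xs i , isS i) , nxt (sucMod i)
          }
          where
          xs : Fin (suc r) → Vtx X
          -- The shift by one along the cycle pairs `y = s(c t)` with its worst partner, so that
          -- `xs t` and `ys t` are matched in `M`.
          xs t = succ (c t)
          ys : Fin (suc r) → Vtx (other X)
          ys t = proj₁ (via (c-has t))
          nxt : ∀ t → NextOf P M X (ys t) (xN (xs t))
          nxt t = proj₂ (proj₂ (via (c-has t)))
          isS : ∀ t → IsS H P M X (xs t) (ys (sucMod t))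
          isS t = subst (λ x → IsS H P M X x (ys (sucMod t))) (c-suc t) (proj₁ (proj₂ (via (c-has (sucMod t)))))
          xs-inj : Injective _≡_ _≡_ xs
          xs-inj {t} {u} eq = sucMod-injective (c-inj (trans (c-suc t) (trans eq (sym (c-suc u)))))

      arc⇒cand : HasArc P X (H , M) → ∃ HasCand
      arc⇒cand (xN x , yN y , cand , _) = x , y , cand
      arc⇒cand (yN y , _ , (x , cand , _) , _) = x , y , cand

      progress : HasArc P X (H , M) → ∃ (Step P X (H , M))
      progress arc with finite-choiceV X follow
      ... | inj₁ step = step
      ... | inj₂ continues with x , has ← arc⇒cand arc =
        let ρ = rotation continues x has ; M′ , rot = rotate ρ in (H , M′) , case-ii ρ rot

-- Legal assignments

module Legality {nA nB : ℕ} (G : Graph nA nB) (P : Prefs nA nB) (wf : WellFormed G P)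
  (L : AsgSet) (legal : LegalProperty G P L) where

  unblocked : ∀ {M M′} → L M ≡ true → L M′ ≡ true → ¬ Blocks P M M′
  unblocked {M} {M′} l l′ blocks =
    case trans (sym l′) (Equivalence.to (proj₂ legal M′ (proj₁ legal M′ l′)) (M , l , blocks)) of λ ()

  unblocked⇒legal : ∀ {M} → IsAssignment G P M → (∀ M′ → L M′ ≡ true → ¬ Blocks P M′ M) → L M ≡ true
  unblocked⇒legal {M} asg ¬blocks with true-or-false (L M)
  ... | inj₁ l  = l
  ... | inj₂ ¬l with M′ , l′ , blocks ← Equivalence.from (proj₂ legal M asg) ¬l =
    contradiction blocks (¬blocks M′ l′)

  module Versus {M₁ M₂} (l₁ : L M₁ ≡ true) (l₂ : L M₂ ≡ true) =
    Compare G P wf M₁ M₂ (proj₁ legal M₁ l₁) (proj₁ legal M₂ l₂) (unblocked l₁ l₂) (unblocked l₂ l₁)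

  matched⇒deg : ∀ (M : Graph nA nB) a b → M ∋ (a , b) → ¬ degA M a < 1
  matched⇒deg M a b m <1 = contradiction
    (subst (1 ≤_) (sym (degA≡count M a)) (count-∃ (λ b → entry M (a , b)) b m)) (<⇒≱ <1)

  -- For schools, a new edge at an underfull `b` would make its student prefer `M`, and then `b` is
  -- full in `M`. For students, one matched only in `M′` would prefer `M′` and hence be matched in
  -- `M` too.
  underfull-common : ∀ X {M M′} → L M ≡ true → L M′ ≡ true → ∀ x y →
    degY M X y < quotaY P X y → M′ ∋ edge X x y → M ∋ edge X x y
  underfull-common A {M} {M′} l l′ a b <q m′ with ∋? M (a , b)
  ... | yes m = m
  ... | no ¬m = contradiction <q (≤⇒≯ (M₁-full (accepted⇒prefers₁ m′ ¬m (inj₁ <q)) m′))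
    where open Versus l l′
  underfull-common B {M} {M′} l l′ b a <1 m′
    with b₁ , m ← Versus.prefers₁⇒matched₂ l′ l {a} (b , m′ , λ b₂ m → contradiction <1 (matched⇒deg M a b₂ m)) =
    contradiction <1 (matched⇒deg M a b₁ m)

  module _ {H M M′ : Graph nA nB} (l : L M ≡ true) (l′ : L M′ ≡ true)
    (M′⊆H : ∀ a b → M′ ∋ (a , b) → H ∋ (a , b)) where

    -- The candidate is the `M′`-school of `a`: by exchange it holds in `M` a student who prefers
    -- `M`, and it ranks `a` above that student.
    candidateA : ∀ {a} → Versus.Prefers₁ l l′ a → ∃ (Cand H P M A a)
    candidateA {a} pr
      with b₁ , m′ ← Versus.prefers₁⇒matched₂ l l′ pr
      with a₁ , pr₁ , m ← Versus.prefers₁-exchange l l′ pr m′ =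
      b₁ , M′⊆H a b₁ m′ , (λ m → Versus.M₂∌ l l′ pr m m′) , a₁ , m , Versus.M₂-better l l′ pr₁ m m′

    -- The candidate is a student whom `b` receives in `M′` by exchange: that student prefers `b` to
    -- its own `M`-school.
    candidateB : ∀ {a b} → Versus.Prefers₁ l′ l a → M ∋ (a , b) → ∃ (Cand H P M B b)
    candidateB {a} {b} pr m
      with a₁ , pr₁ , m′ ← Versus.prefers₁-exchange l′ l pr m
      with b₁ , m₁ ← Versus.prefers₁⇒matched₂ l′ l pr₁ =
      a₁ , M′⊆H a₁ b m′ , Versus.M₂∌ l′ l pr₁ m′ , b₁ , m₁ , Versus.prefers₁⇒< l′ l pr₁ m′ m₁

    cand⇒¬sink : ∀ X {x} → ∃ (Cand H P M X x) → ¬ Sink H P M X (xN x)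
    cand⇒¬sink X {x} has snk with y , isS ← best-candidate H P M X x has = snk (yN y) isS

    -- For `X = A` the student `a` prefers `M`, hence so does the worst `M`-partner of `b`. For
    -- `X = B` the student prefers `M′`, and its `M`-school is the vertex in question. Either way
    -- that vertex has a candidate; `∅N` is excluded because `y` is full.
    removed-illegal : ∀ X x y n → Cand H P M X x y → NextOf P M X y n → Sink H P M X n → ¬ M′ ∋ edge X x y
    removed-illegal A a b n (_ , ¬m , worse) nxt snk m′ = absurd n nxt snk
      where
      open Versus l l′
      pr : Prefers₁ a
      pr = accepted⇒prefers₁ m′ ¬m (inj₂ worse)
      absurd : ∀ n → NextOf P M A b n → Sink H P M A n → ⊥
      absurd ∅N <q _ = contradiction <q (≤⇒≯ (M₁-full pr m′))
      absurd (xN a₁) (_ , m₁ , worst) snk = cand⇒¬sink A (candidateA (worst-prefers₁ pr m′ m₁ worst)) snk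
    removed-illegal B b a n (_ , _ , b₀ , m₀ , lt) nxt snk m′ = absurd n nxt snk
      where
      open Versus l′ l
      pr : Prefers₁ a
      pr = b , m′ , λ b₁ m₁ → subst (λ z → rankA P a b < rankA P a z)
        (partner-unique G P M (proj₁ legal M l) a b₀ b₁ m₀ m₁) lt
      absurd : ∀ n → NextOf P M B a n → Sink H P M B n → ⊥
      absurd ∅N <1 _ = matched⇒deg M a b₀ m₀ <1
      absurd (xN b₁) (_ , m₁ , _) snk = cand⇒¬sink B (candidateB pr m₁) snk

    -- For `X = A` a failure yields a student preferring `M`, who has a candidate. For `X = B` every
    -- student matched in `M′` is matched in `M`, and one who likes its `M′`-school better is itself
    -- a candidate of that school.
    optimal : ∀ X → (∀ x y → ¬ Cand H P M X x y) → YBetter P X M M′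
    optimal A none a b m
      with Fin.any? (λ b′ → ∋? M′ (a , b′) ×-dec ((b′ Fin.≟ b) ⊎-dec (rankA P a b′ <? rankA P a b)))
    ... | yes found = found
    ... | no ¬found = ⊥-elim (uncurry (none a) (candidateA {a} (b , m , λ b′ m′ → ≤∧≢⇒<
      (≮⇒≥ λ lt → ¬found (b′ , m′ , inj₂ lt))
      (λ eq → ¬found (b′ , m′ , inj₁ (sym (proj₁ wf a b b′
        (proj₁ (proj₁ legal M l) a b m) (proj₁ (proj₁ legal M′ l′) a b′ m′) eq)))))))
    optimal B none a b′ m′ with Fin.any? (λ b → ∋? M (a , b))
    ... | no ¬matched = contradiction
      (Versus.prefers₁⇒matched₂ l′ l {a} (b′ , m′ , λ b m → contradiction (b , m) ¬matched)) ¬matched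
    ... | yes (b , m) with b Fin.≟ b′
    ... | yes b≡b′ = b , m , inj₁ b≡b′
    ... | no  b≢b′ = b , m , inj₂ (≰⇒> λ le → none b′ a
      (M′⊆H a b′ m′ ,
       (λ m₁ → b≢b′ (partner-unique G P M (proj₁ legal M l) a b b′ m m₁)) ,
       b , m , ≤∧≢⇒< le (λ eq → b≢b′ (sym (proj₁ wf a b′ b
         (proj₁ (proj₁ legal M′ l′) a b′ m′) (proj₁ (proj₁ legal M l) a b m) eq)))))

-- The algorithm

module Algorithm {nA nB : ℕ} (G : Graph nA nB) (P : Prefs nA nB) (wf : WellFormed G P) (X : Side) where

  -- The last two fields range over all sets with the legal property, matching the definition of
  -- `YOptimalLegal`.
  record Invariant (s : State) : Set where
    field
      H⊆G        : ∀ x y → proj₁ s ∋ edge X x y → G ∋ edge X x y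
      assignment : YAssignment (proj₁ s) P X (proj₂ s)
      fullStable : FullStable (proj₁ s) P X (proj₂ s)
      legal      : ∀ L → LegalProperty G P L → L (proj₂ s) ≡ true
      legal⊆H    : ∀ L → LegalProperty G P L → ∀ M′ → L M′ ≡ true →
                   ∀ a b → M′ ∋ (a , b) → proj₁ s ∋ (a , b)

  initial : ∀ {M₀} → Stable G P M₀ → Invariant (G , M₀)
  initial {M₀} (asg , ¬blocks) = record
    { H⊆G        = λ _ _ g → g
    ; assignment = to-YAssignment X G P M₀ asg
    ; fullStable = λ x y g _ sb → on-edges X ¬blocks x y g (sym⇒edge X x y sb)
    ; legal      = λ L lp → Legality.unblocked⇒legal G P wf L lp asg
                     λ M′ l′ (a , b , m′ , blocks) → ¬blocks a b (proj₁ (proj₁ lp M′ l′) a b m′) blocks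
    ; legal⊆H    = λ L lp M′ l′ → proj₁ (proj₁ lp M′ l′)
    }
    where open StudentAcceptance G P M₀ asg

  preserved : ∀ {s s′} → Step P X s s′ → Invariant s → Invariant s′
  preserved (case-i {H} {M} {H′} x y n (cand , _) (_ , nxt) snk removed) inv = record
    { H⊆G        = λ x₁ y₁ h′ → H⊆G x₁ y₁ (proj₁ (Equivalence.to (H′∋ x₁ y₁) h′))
    ; assignment = (λ x₁ y₁ m → Equivalence.from (H′∋ x₁ y₁)
                     (proj₁ assignment x₁ y₁ m , λ eq → proj₁ (proj₂ cand) (subst (M ∋_) (sym eq) m))) ,
                   proj₂ assignment
    ; fullStable = λ x₁ y₁ h′ → fullStable x₁ y₁ (proj₁ (Equivalence.to (H′∋ x₁ y₁) h′))
    ; legal      = legal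
    ; legal⊆H    = λ L lp M′ l′ a b m′ → Equivalence.from (removed a b)
                     (legal⊆H L lp M′ l′ a b m′ , λ eq →
                      Legality.removed-illegal G P wf L lp (legal L lp) l′ (legal⊆H L lp M′ l′)
                        X x y n cand nxt snk (subst (M′ ∋_) (sym eq) m′))
    }
    where
    open Invariant inv
    H′∋ : ∀ x₁ y₁ → H′ ∋ edge X x₁ y₁ ⇔ (H ∋ edge X x₁ y₁ × edge X x y ≢ edge X x₁ y₁)
    H′∋ = on-edges X removed
  preserved (case-ii {H} {M} {M′} ρ rot) inv = record
    { H⊆G        = H⊆G
    ; assignment = assignment′
    ; fullStable = rotated-FullStable fullStable
    ; legal      = λ L lp → Legality.unblocked⇒legal G P wf L lp asg-G λ M″ l″ (a , b , m″ , blocks) →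
                     from-edges X {λ e → M″ ∋ e → ¬ EdgeBlocks P M′ (proj₁ e) (proj₂ e)}
                       (no-block L lp M″ l″) a b m″ blocks
    ; legal⊆H    = legal⊆H
    }
    where
    open Invariant inv
    open Rotate {M′ = M′} ρ rot
    assignment′ : YAssignment H P X M′
    assignment′ = rotated-YAssignment assignment
    asg-G : IsAssignment G P M′
    asg-G = from-YAssignment X G P M′ ((λ x y m → H⊆G x y (proj₁ assignment′ x y m)) , proj₂ assignment′)
    no-block : ∀ L (lp : LegalProperty G P L) M″ → L M″ ≡ true → ∀ x y → M″ ∋ edge X x y →
      ¬ EdgeBlocks P M′ (proj₁ (edge X x y)) (proj₂ (edge X x y))
    no-block L lp M″ l″ x y m″ blocks
      with sb ← StudentAcceptance.edge⇒sym G P M′ asg-G X x y blocks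
      with m≤n⇒m<n∨m≡n (proj₂ (proj₂ assignment′) y)
    ... | inj₂ full = rotated-FullStable fullStable x y
      (on-edges X {λ e → M″ ∋ e → H ∋ e} (legal⊆H L lp M″ l″) x y m″) full sb
    -- With `y` underfull, the legal edge already lies in `M`, and a rotation gives up edges only at
    -- full vertices, so it is still present and cannot block.
    ... | inj₁ <q = proj₁ sb (rotated-underfull x y <q′
      (Legality.underfull-common G P wf L lp X (legal L lp) l″ x y <q′ m″))
      where
      <q′ : degY M X y < quotaY P X y
      <q′ = subst (_< quotaY P X y) (degY-≡ y) <q

  reachable : ∀ {s s′} → Star (Step P X) s s′ → Invariant s → Invariant s′
  reachable ε            inv = inv
  reachable (step ◅ run) inv = reachable run (preserved step inv)

  rankY-injective : ∀ y x x′ → G ∋ edge X x y → G ∋ edge X x′ y → rankY P X y x ≡ rankY P X y x′ → x ≡ x′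
  rankY-injective = go X
    where
    go : ∀ X y x x′ → G ∋ edge X x y → G ∋ edge X x′ y → rankY P X y x ≡ rankY P X y x′ → x ≡ x′
    go A = proj₁ (proj₂ wf)
    go B = proj₁ wf

  no-arc⇒no-cand : ∀ {H M} → ¬ HasArc P X (H , M) → ∀ x y → ¬ Cand H P M X x y
  no-arc⇒no-cand {H} {M} ¬arc x y cand with y′ , isS ← best-candidate H P M X x (y , cand) =
    ¬arc (xN x , yN y′ , isS)

theorem5 : ∀ {nA nB} (G : Graph nA nB) (P : Prefs nA nB) → WellFormed G P →
    (X : Side) (M₀ : Graph nA nB) → YOptimalStable G P X M₀ →
    Acc (λ s' s → Step P X s s') (G , M₀) ×
    (∀ s → Star (Step P X) (G , M₀) s → HasArc P X s → ∃ (Step P X s)) ×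
    (∀ H M → Star (Step P X) (G , M₀) (H , M) → ¬ HasArc P X (H , M) →
    YOptimalLegal G P X M)
theorem5 G P wf X M₀ (stable , _) =
  steps-terminate P X (G , M₀) ,
  (λ (H , M) run →
    let open Invariant (reachable run (initial stable)) in
    progress H P M X (proj₂ (proj₂ assignment)) λ y x x′ m m′ →
      rankY-injective y x x′ (H⊆G x y (proj₁ assignment x y m)) (H⊆G x′ y (proj₁ assignment x′ y m′))) ,
  λ H M run ¬arc L lp →
    let open Invariant (reachable run (initial stable)) in
    legal L lp , λ M′ l′ →
      Legality.optimal G P wf L lp {H} {M} {M′} (legal L lp) l′ (legal⊆H L lp M′ l′) X (no-arc⇒no-cand {H} {M} ¬arc)
  where open Algorithm G P wf X
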